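{- Let $\mathcal{F}$ be the set of finite subsets of $\mathbb{Q}_{>0}$, and let $\rho:\mathbb{Q}_{<0}\to\mathcal{F}$ be a map such that for every $F\in\mathcal{F}$ the fiber $\rho^{ -1}(F)$ is dense and codense in $\mathbb{Q}_{<0}$. Let $A\subseteq\mathbb{Q}^2$ be the binary relation defined by $A(x,y)\iff x<0<y$ and $y\in\rho(x)$. Let $\mathcal{R}\succcurlyeq(\mathbb{Q},<,0,A)$ be an $\aleph_1$-saturated elementary extension with infinite elements (relative to the elements of $\mathbb{Q}$). Then the open core of $\mathcal{R}$ is not o-minimal.
   Context: "Definable" always means definable with parameters. For a structure $\mathcal{R}=(R,<,\ldots)$ expanding a dense linear order without endpoints, give $R$ the order topology and $R^n$ the product topology. The open core $\mathcal{R}^{\circ}$ of $\mathcal{R}$ is the structure with universe $R$ whose language consists of a relation symbol for each open set $U\subseteq R^n$, for every $n$, that is definable (with parameters) in $\mathcal{R}$. A structure is o-minimal if every subset of its universe definable with parameters is a finite union of points and intervals (with endpoints in the universe or $\pm\infty$). An element of $\mathcal{R}$ is infinite relative to $\mathbb{Q}$ if it is greater than every element of $\mathbb{Q}$. A set $D\subseteq\mathbb{Q}_{<0}$ is codense in $\mathbb{Q}_{<0}$ if $\mathbb{Q}_{<0}\setminus D$ is dense in $\mathbb{Q}_{<0}$. -}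

module Defs where

open import Data.Empty.Polymorphic using (⊥)
open import Data.Fin.Base using (Fin)
open import Data.List.Base using (List)
open import Data.List.Membership.Propositional using (_∈_)
open import Data.List.Relation.Binary.BagAndSetEquality using (_∼[_]_; set)
open import Data.List.Relation.Unary.All using (All)
open import Data.List.Relation.Unary.Any using (Any)
open import Data.Nat.Base using (ℕ; suc; _+_)
open import Data.Product.Base using (Σ; Σ-syntax; ∃; ∃-syntax; _×_; _,_; proj₁)
open import Data.Rational.Base using (ℚ; 0ℚ) renaming (_<_ to _<ℚ_)
open import Data.Sum.Base using (_⊎_)
open import Data.Vec.Base using (Vec; []; _∷_; _++_; head; lookup; map)
open import Data.Vec.Relation.Binary.Pointwise.Inductive using (Pointwise)
open import Function.Bundles using (_⇔_; _↣_)
open import Level using (Level; 0ℓ) renaming (suc to lsuc; _⊔_ to _⊔ˡ_)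
open import Relation.Binary.Core using (Rel)
open import Relation.Binary.PropositionalEquality.Core using (_≡_)
open import Relation.Nullary.Construct.Add.Extrema using (_±; [_])
open import Relation.Unary using (Pred; _⊆_; _≐_; ∁)
import Relation.Binary.Construct.Add.Extrema.Strict as Strict

------------------------------------------------------------------------
-- First-order logic with equality

record Language (l : Level) : Set (lsuc l) where
  field
    Fun      : ℕ → Set l
    Relation : ℕ → Set l

module _ {l : Level} (L : Language l) where
  open Language L

  data Term (n : ℕ) : Set l where
    var : Fin n → Term n
    app : ∀ {k} → Fun k → Vec (Term n) k → Term n

  -- The free variables are indexed by Fin n; a quantifier binds variable zero.
  data Formula (n : ℕ) : Set l where
    rel         : ∀ {k} → Relation k → Vec (Term n) k → Formula n
    _≈_         : Term n → Term n → Formula n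
    bot         : Formula n
    _∧_ _∨_ _⇒_ : Formula n → Formula n → Formula n
    all ex      : Formula (suc n) → Formula n

  record Structure (ℓ : Level) : Set (l ⊔ˡ lsuc ℓ) where
    field
      Carrier : Set ℓ
      ⟦_⟧ᶠ    : ∀ {k} → Fun k → Vec Carrier k → Carrier
      ⟦_⟧ʳ    : ∀ {k} → Relation k → Pred (Vec Carrier k) ℓ

open Structure public

module _ {l ℓ : Level} {L : Language l} where

  eval  : ∀ {n} (M : Structure L ℓ) → Vec (Carrier M) n → Term L n → Carrier M
  evals : ∀ {n k} (M : Structure L ℓ) →
          Vec (Carrier M) n → Vec (Term L n) k → Vec (Carrier M) k
  eval M v (var i)    = lookup v i
  eval M v (app f ts) = ⟦ M ⟧ᶠ f (evals M v ts)
  evals M v []        = []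
  evals M v (t ∷ ts)  = eval M v t ∷ evals M v ts

  infix 4 _⊨_[_]

  _⊨_[_] : ∀ {n} (M : Structure L ℓ) → Formula L n → Vec (Carrier M) n → Set ℓ
  M ⊨ rel r ts [ v ] = ⟦ M ⟧ʳ r (evals M v ts)
  M ⊨ s ≈ t    [ v ] = eval M v s ≡ eval M v t
  M ⊨ bot      [ v ] = ⊥
  M ⊨ φ ∧ ψ    [ v ] = (M ⊨ φ [ v ]) × (M ⊨ ψ [ v ])
  M ⊨ φ ∨ ψ    [ v ] = (M ⊨ φ [ v ]) ⊎ (M ⊨ ψ [ v ])
  M ⊨ φ ⇒ ψ    [ v ] = M ⊨ φ [ v ] → M ⊨ ψ [ v ]
  M ⊨ all φ    [ v ] = (a : Carrier M) → M ⊨ φ [ a ∷ v ]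
  M ⊨ ex φ     [ v ] = Σ[ a ∈ Carrier M ] M ⊨ φ [ a ∷ v ]

module _ {l ℓ : Level} {L : Language l} (M : Structure L ℓ) where

  -- U is defined by φ(x₁,…,xₙ,b₁,…,bₘ) for some parameters bⱼ in the universe.
  Definable : ∀ {n} → Pred (Vec (Carrier M) n) ℓ → Set (l ⊔ˡ ℓ)
  Definable {n} U =
    ∃[ m ] Σ[ φ ∈ Formula L (n + m) ] Σ[ b ∈ Vec (Carrier M) m ]
      U ≐ (λ v → M ⊨ φ [ v ++ b ])

  -- Formulas in one free variable with parameters from C.
  Formula₁[_] : Pred (Carrier M) ℓ → Set (l ⊔ˡ ℓ)
  Formula₁[ C ] = ∃[ m ] (Formula L (1 + m) × Vec (∃ C) m)

  Satisfies : {C : Pred (Carrier M) ℓ} → Carrier M → Formula₁[ C ] → Set ℓ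
  Satisfies a (m , φ , b) = M ⊨ φ [ a ∷ map proj₁ b ]

  FinitelySatisfiable : {C : Pred (Carrier M) ℓ} →
                        Pred Formula₁[ C ] (l ⊔ˡ ℓ) → Set (l ⊔ˡ ℓ)
  FinitelySatisfiable {C} p =
    (φs : List Formula₁[ C ]) → All p φs → ∃[ a ] All (Satisfies a) φs

  Realized : {C : Pred (Carrier M) ℓ} →
             Pred Formula₁[ C ] (l ⊔ˡ ℓ) → Set (l ⊔ˡ ℓ)
  Realized p = ∃[ a ] (p ⊆ Satisfies a)

  -- Types are finitely satisfiable sets of formulas, not required to be
  -- complete; a set of parameters has size < ℵ₁ when it injects into ℕ.
  ℵ₁-Saturated : Set (lsuc (l ⊔ˡ ℓ))
  ℵ₁-Saturated =
    (C : Pred (Carrier M) ℓ) → ∃ C ↣ ℕ →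
    (p : Pred Formula₁[ C ] (l ⊔ˡ ℓ)) → FinitelySatisfiable p → Realized p

-- Elementary extensions M ≼ N, with the inclusion given as an embedding.
record _≼_ {l ℓ₁ ℓ₂ : Level} {L : Language l}
           (M : Structure L ℓ₁) (N : Structure L ℓ₂) : Set (l ⊔ˡ ℓ₁ ⊔ˡ ℓ₂) where
  field
    embed      : Carrier M → Carrier N
    elementary : ∀ {n} (φ : Formula L n) (v : Vec (Carrier M) n) →
                 (M ⊨ φ [ v ]) ⇔ (N ⊨ φ [ map embed v ])

------------------------------------------------------------------------
-- Intervals and the order topology

module _ {ℓ : Level} {R : Set ℓ} (_<_ : Rel R ℓ) where
  open Strict _<_ using (_<±_)

  -- Open intervals with endpoints in R ∪ {±∞}.
  Interval : Set ℓ
  Interval = (R ±) × (R ±)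

  _∈ᴵ_ : R → Interval → Set ℓ
  x ∈ᴵ (a , b) = (a <± [ x ]) × ([ x ] <± b)

  -- Openness in the product topology, via its basis of open boxes.
  Open : ∀ {n} → Pred (Vec R n) ℓ → Set ℓ
  Open {n} U = ∀ v → U v →
    Σ[ B ∈ Vec Interval n ]
      (Pointwise _∈ᴵ_ v B × (∀ w → Pointwise _∈ᴵ_ w B → U w))

  data Piece : Set ℓ where
    point    : R → Piece
    interval : Interval → Piece

  _∈ᴾ_ : R → Piece → Set ℓ
  x ∈ᴾ point a    = x ≡ a
  x ∈ᴾ interval I = x ∈ᴵ I

  FiniteUnion : Pred R ℓ → Set ℓ
  FiniteUnion D = Σ[ ps ∈ List Piece ] D ≐ (λ x → Any (x ∈ᴾ_) ps)

OMinimal : {l ℓ : Level} {L : Language l} (M : Structure L ℓ) →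
           Rel (Carrier M) ℓ → Set (l ⊔ˡ lsuc ℓ)
OMinimal {ℓ = ℓ} M _<_ =
  (D : Pred (Carrier M) ℓ) → Definable M {1} (λ v → D (head v)) → FiniteUnion _<_ D

------------------------------------------------------------------------
-- The open core

module _ {l ℓ : Level} {L : Language l}
         (M : Structure L ℓ) (_<_ : Rel (Carrier M) ℓ) where

  openCoreLanguage : Language (l ⊔ˡ lsuc ℓ)
  openCoreLanguage = record
    { Fun      = λ _ → ⊥
    ; Relation = λ n → Σ[ U ∈ Pred (Vec (Carrier M) n) ℓ ] (Open _<_ U × Definable M U)
    }

  openCore : Structure openCoreLanguage ℓ
  openCore = record
    { Carrier = Carrier M
    ; ⟦_⟧ᶠ    = λ ()
    ; ⟦_⟧ʳ    = λ (U , _) → U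
    }

------------------------------------------------------------------------
-- The structure (ℚ, <, 0, A)

ℚ<0 ℚ>0 : Set
ℚ<0 = Σ[ q ∈ ℚ ] q <ℚ 0ℚ
ℚ>0 = Σ[ q ∈ ℚ ] 0ℚ <ℚ q

-- Finite subsets of ℚ>0, presented by lists of their elements; two lists
-- present the same subset when they are related by _∼[ set ]_.
𝓕 : Set
𝓕 = List ℚ>0

Dense : Pred ℚ<0 0ℓ → Set
Dense D = (a b : ℚ<0) → proj₁ a <ℚ proj₁ b →
  Σ[ d ∈ ℚ<0 ] (D d × (proj₁ a <ℚ proj₁ d) × (proj₁ d <ℚ proj₁ b))

Codense : Pred ℚ<0 0ℓ → Set
Codense D = Dense (∁ D)

fiber : (ℚ<0 → 𝓕) → 𝓕 → Pred ℚ<0 0ℓ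
fiber ρ F x = ρ x ∼[ set ] F

data FunSym : ℕ → Set where
  zeroˢ : FunSym 0

data RelSym : ℕ → Set where
  <ˢ Aˢ : RelSym 2

L<0A : Language 0ℓ
L<0A = record { Fun = FunSym ; Relation = RelSym }

graph : (ℚ<0 → 𝓕) → Rel ℚ 0ℓ
graph ρ x y = Σ[ x<0 ∈ x <ℚ 0ℚ ] Σ[ 0<y ∈ 0ℚ <ℚ y ] (y , 0<y) ∈ ρ (x , x<0)

ℚ-structure : (ℚ<0 → 𝓕) → Structure L<0A 0ℓ
ℚ-structure ρ = record
  { Carrier = ℚ
  ; ⟦_⟧ᶠ    = λ { zeroˢ [] → 0ℚ }
  ; ⟦_⟧ʳ    = λ { <ˢ (x ∷ y ∷ []) → x <ℚ y
                ; Aˢ (x ∷ y ∷ []) → graph ρ x y }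
  }

order : {ℓ : Level} (R : Structure L<0A ℓ) → Rel (Carrier R) ℓ
order R x y = ⟦ R ⟧ʳ <ˢ (x ∷ y ∷ [])

HasInfiniteElement : {ℓ : Level} {ρ : ℚ<0 → 𝓕} {R : Structure L<0A ℓ} →
                     ℚ-structure ρ ≼ R → Set ℓ
HasInfiniteElement {R = R} e = ∃[ x ] ∀ (q : ℚ) → order R (_≼_.embed e q) x

{-# OPTIONS --safe #-}
-- For a in R write A_a = {y : A(a,y)}. In ℚ every A_x is finite, so in R every A_a is
-- closed, and it contains no nonempty open interval: both facts are first-order. Hence the
-- complement of A_a is open, and A_a is definable in the open core. By saturation some A_a
-- contains the image of every positive integer; were A_a a finite union of points and
-- intervals, two of these images would lie in the same piece, which could only be an
-- interval, and everything between the two would lie in A_a.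
module Submission where

open import Defs
open import Data.Empty.Polymorphic using (⊥-elim)
open import Data.Fin.Base as Fin using (Fin; zero; suc; toℕ)
open import Data.Fin.Properties using (pigeonhole)
open import Data.Integer.Base using (+_; +<+)
import Data.Integer.Properties as ℤ
open import Data.List.Base as List using (List; []; _∷_; length)
open import Data.List.Membership.Propositional using (_∈_; lose)
open import Data.List.Membership.Propositional.Properties using (∈-map⁺; ∈-lookup)
open import Data.List.Relation.Unary.All as All using (All; []; _∷_)
open import Data.List.Relation.Unary.Any as Any using (Any; here; there)
open import Data.List.Relation.Unary.Any.Properties using (lookup-index)
open import Data.Nat.Base as ℕ using (ℕ; s<s)
open import Data.Nat.Coprimality as Coprimality using (1-coprimeTo)
open import Data.Nat.Properties using (n<1+n)
open import Data.Product.Base using (∃; ∃-syntax; ∃₂; _×_; _,_; proj₁; proj₂)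
open import Data.Rational.Base using (ℚ; mkℚ; 0ℚ; 1ℚ; -½; _+_; -_; _⊓_; _⊔_; *<*)
  renaming (_<_ to _<ℚ_)
open import Data.Rational.Properties as ℚ using (_<?_)
open import Data.Sum.Base using (inj₁; inj₂)
open import Data.Vec.Base using (Vec; []; _∷_; head)
open import Data.Vec.Relation.Binary.Pointwise.Inductive using ([]; _∷_)
open import Function.Base using (_∘_)
open import Function.Bundles using (_↣_; mk↣; module Equivalence)
open import Level using (Level)
open import Relation.Binary.Construct.Add.Extrema.Strict using (<±-trans; [_])
open import Relation.Binary.Definitions using (tri<; tri≈; tri>)
open import Relation.Binary.PropositionalEquality.Core using (_≡_; refl; sym; trans; subst)
open import Relation.Nullary.Construct.Add.Extrema using () renaming ([_] to fin)
open import Relation.Nullary.Decidable using (yes; no; from-yes)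
open import Relation.Nullary.Negation.Core using (¬_; contradiction)
open import Relation.Unary using (Pred)

-- Arithmetic and order of the rationals.

positiveInteger : ℕ → ℚ
-- The value is n + 1, so that index 0 is positive too; the second argument of `mkℚ` is the
-- denominator minus one.
positiveInteger n = mkℚ (+ ℕ.suc n) 0 (Coprimality.sym (1-coprimeTo (ℕ.suc n)))

positiveInteger-pos : ∀ n → 0ℚ <ℚ positiveInteger n
positiveInteger-pos n = ℚ.positive⁻¹ (positiveInteger n)

positiveInteger-mono-< : ∀ {m n} → m ℕ.< n → positiveInteger m <ℚ positiveInteger n
positiveInteger-mono-< m<n =
  *<* (ℤ.*-monoʳ-<-pos (+ 1) (+<+ (s<s m<n)))

p<p+1 : ∀ p → p <ℚ p + 1ℚ
p<p+1 p = subst (_<ℚ p + 1ℚ) (ℚ.+-identityʳ p) (ℚ.+-monoʳ-< p (from-yes (0ℚ <? 1ℚ)))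

p-1<p : ∀ p → p + - 1ℚ <ℚ p
p-1<p p = subst (p + - 1ℚ <ℚ_) (ℚ.+-identityʳ p) (ℚ.+-monoʳ-< p (from-yes (- 1ℚ <? 0ℚ)))

⊔-lub-< : ∀ {p q r} → p <ℚ r → q <ℚ r → p ⊔ q <ℚ r
⊔-lub-< {p} {q} p<r q<r with ℚ.⊔-sel p q
... | inj₁ eq = subst (_<ℚ _) (sym eq) p<r
... | inj₂ eq = subst (_<ℚ _) (sym eq) q<r

⊓-glb-< : ∀ {p q r} → p <ℚ q → p <ℚ r → p <ℚ q ⊓ r
⊓-glb-< {_} {q} {r} p<q p<r with ℚ.⊓-sel q r
... | inj₁ eq = subst (_ <ℚ_) (sym eq) p<q
... | inj₂ eq = subst (_ <ℚ_) (sym eq) p<r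

-- An entry other than `p` pulls the end on its side of `p` in at least as far as itself; since ends
-- are excluded, it is cut off.
isolated : ∀ (qs : List ℚ) p →
  ∃₂ λ l u → l <ℚ p × p <ℚ u × (∀ {q} → l <ℚ q → q <ℚ u → q ∈ qs → q ≡ p)
isolated [] p = p + - 1ℚ , p + 1ℚ , p-1<p p , p<p+1 p , λ _ _ ()
isolated (c ∷ qs) p with isolated qs p | ℚ.<-cmp c p
... | l , u , l<p , p<u , iso | tri< c<p _ _ =
  l ⊔ c , u , ⊔-lub-< l<p c<p , p<u , λ where
    l<q q<u (here refl) → contradiction (ℚ.≤-<-trans (ℚ.p≤q⊔p l c) l<q) (ℚ.<-irrefl refl)
    l<q q<u (there q∈)  → iso (ℚ.≤-<-trans (ℚ.p≤p⊔q l c) l<q) q<u q∈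
... | l , u , l<p , p<u , iso | tri≈ _ c≡p _ =
  l , u , l<p , p<u , λ where
    l<q q<u (here refl) → c≡p
    l<q q<u (there q∈)  → iso l<q q<u q∈
... | l , u , l<p , p<u , iso | tri> _ _ p<c =
  l , u ⊓ c , l<p , ⊓-glb-< p<u p<c , λ where
    l<q q<u (here refl) → contradiction (ℚ.<-≤-trans q<u (ℚ.p⊓q≤q u c)) (ℚ.<-irrefl refl)
    l<q q<u (there q∈)  → iso l<q (ℚ.<-≤-trans q<u (ℚ.p⊓q≤p u c)) q∈

-- First-order sentences about the fibres of `A`.

infix 25 _<′_ _A′_

_<′_ _A′_ : ∀ {n} → Fin n → Fin n → Formula L<0A n
i <′ j = rel <ˢ (var i ∷ var j ∷ [])
i A′ j = rel Aˢ (var i ∷ var j ∷ [])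

pattern v₀ = zero
pattern v₁ = suc zero
pattern v₂ = suc v₁
pattern v₃ = suc v₂
pattern v₄ = suc v₃

-- In `fibres-discrete` the innermost variables `v₄` to `v₀` are x, y, l, u, w. As y ranges over all
-- points, in the fibre or not, this one sentence makes every fibre both closed and discrete.
-- Transitivity is listed because `R` inherits the order axioms only by elementarity.
<-transitive fibres-discrete fibres-codense : Formula L<0A 0
<-transitive    = all (all (all (v₂ <′ v₁ ⇒ (v₁ <′ v₀ ⇒ v₂ <′ v₀))))
fibres-discrete =
  all (all (ex (ex (v₁ <′ v₂ ∧ (v₂ <′ v₀ ∧
    all (v₂ <′ v₀ ⇒ (v₀ <′ v₁ ⇒ (v₄ A′ v₀ ⇒ (var v₀ ≈ var v₃)))))))))
fibres-codense  =
  all (all (all (v₁ <′ v₀ ⇒ ex (v₂ <′ v₀ ∧ (v₀ <′ v₁ ∧ (v₃ A′ v₀ ⇒ bot))))))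

-- Verification in the rationals.

module _ (ρ : ℚ<0 → 𝓕) where

  graph⊆list : ∀ x → ∃[ qs ] (∀ {y} → graph ρ x y → y ∈ qs)
  graph⊆list x with x <? 0ℚ
  ... | yes x<0 = List.map proj₁ (ρ (x , x<0)) , λ where
    -- `graph` carries its own proof of `x <ℚ 0ℚ`, which irrelevance identifies with the one found
    -- by the decision.
    (x<0′ , _ , y∈) → ∈-map⁺ proj₁
      (subst (λ x<0 → (_ , _) ∈ ρ (x , x<0)) (ℚ.<-irrelevant x<0′ x<0) y∈)
  ... | no x≮0 = [] , λ (x<0 , _) → contradiction x<0 x≮0

  ℚ-<-transitive : ℚ-structure ρ ⊨ <-transitive [ [] ]
  ℚ-<-transitive _ _ _ = ℚ.<-trans

  ℚ-fibres-discrete : ℚ-structure ρ ⊨ fibres-discrete [ [] ]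
  ℚ-fibres-discrete x y =
    let qs , A⊆qs = graph⊆list x
        l , u , l<y , y<u , iso = isolated qs y
    in l , u , l<y , y<u , λ _ l<w w<u Axw → iso l<w w<u (A⊆qs Axw)

  ℚ-fibres-codense : ℚ-structure ρ ⊨ fibres-codense [ [] ]
  ℚ-fibres-codense x y z y<z =
    let l , u , l<y , y<u , iso = ℚ-fibres-discrete x y
        -- This `w` lies in the isolating interval of `y` but differs from `y`, hence misses the
        -- fibre.
        w , y<w , w<u⊓z = ℚ.<-dense (⊓-glb-< y<u y<z)
        w<u = ℚ.<-≤-trans w<u⊓z (ℚ.p⊓q≤p u z)
        w<z = ℚ.<-≤-trans w<u⊓z (ℚ.p⊓q≤q u z)
    in w , y<w , w<z , λ Axw →
       contradiction y<w (ℚ.<-irrefl (sym (iso w (ℚ.<-trans l<y y<w) w<u Axw)))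

  fibre-realizes : ((F : 𝓕) → Dense (fiber ρ F)) → (ns : List ℕ) →
    ∃[ x ] (∀ {n} → n ∈ ns → graph ρ x (positiveInteger n))
  fibre-realizes dense ns =
    -- The interval from -1 to -½ is an arbitrary choice; density of the fiber over this finite set
    -- gives a point in it.
    let (x , x<0) , ρx∼F , _ = dense (List.map f ns)
          (- 1ℚ , from-yes (- 1ℚ <? 0ℚ)) (-½ , from-yes (-½ <? 0ℚ)) (from-yes (- 1ℚ <? -½))
    in x , λ {n} n∈ → x<0 , positiveInteger-pos n , Equivalence.from ρx∼F (∈-map⁺ f n∈)
    where
    f : ℕ → ℚ>0
    f n = positiveInteger n , positiveInteger-pos n

-- Transfer to the elementary extension.

module _ {ℓ : Level} {ρ : ℚ<0 → 𝓕} {R : Structure L<0A ℓ} (e : ℚ-structure ρ ≼ R) where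
  open _≼_ e

  _<_ _A_ : Carrier R → Carrier R → Set ℓ
  x < y = order R x y
  x A y = ⟦ R ⟧ʳ Aˢ (x ∷ y ∷ [])

  transfer : (φ : Formula L<0A 0) → ℚ-structure ρ ⊨ φ [ [] ] → R ⊨ φ [ [] ]
  transfer φ = Equivalence.to (elementary φ [])

  R-<-trans : ∀ {x y z} → x < y → y < z → x < z
  R-<-trans = transfer <-transitive (ℚ-<-transitive ρ) _ _ _

  R-fibres-discrete : R ⊨ fibres-discrete [ [] ]
  R-fibres-discrete = transfer fibres-discrete (ℚ-fibres-discrete ρ)

  R-fibres-codense : R ⊨ fibres-codense [ [] ]
  R-fibres-codense = transfer fibres-codense (ℚ-fibres-codense ρ)

  integer : ℕ → Carrier R
  integer n = embed (positiveInteger n)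

  integer-mono-< : ∀ {m n} → m ℕ.< n → integer m < integer n
  integer-mono-< m<n =
    Equivalence.to (elementary (v₀ <′ v₁) (_ ∷ _ ∷ [])) (positiveInteger-mono-< m<n)

  integer-injective-< : ∀ {m n} → m ℕ.< n → ¬ integer m ≡ integer n
  integer-injective-< {m} {n} m<n m≡n = contradiction (positiveInteger-mono-< m<n)
    (ℚ.<-irrefl (Equivalence.from
      (elementary (var v₀ ≈ var v₁) (positiveInteger m ∷ positiveInteger n ∷ [])) m≡n))

  fibre-complement : Carrier R → Pred (Vec (Carrier R) 1) ℓ
  fibre-complement a v = R ⊨ v₀ A′ v₁ ⇒ bot [ a ∷ v ]

  -- The isolating interval of `y` can meet the fibre only in `y`, which is not in it.
  fibre-complement-open : ∀ a → Open _<_ (fibre-complement a)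
  fibre-complement-open a (y ∷ []) ¬Aay =
    let l , u , l<y , y<u , iso = R-fibres-discrete a y
    in ((fin l , fin u) ∷ []) , ((([ l<y ]) , ([ y<u ])) ∷ []) , λ where
         (w ∷ []) ((([ l<w ]) , ([ w<u ])) ∷ []) Aaw →
           ¬Aay (subst (a A_) (iso w l<w w<u Aaw) Aaw)

  fibre-complement-definable : ∀ a → Definable R (fibre-complement a)
  fibre-complement-definable a =
    -- Parameters follow the free variables, so `a` is now `v₁`; splitting the vector lets the
    -- concatenation reduce.
    1 , (v₁ A′ v₀ ⇒ bot) , (a ∷ []) ,
    (λ { {_ ∷ []} → λ ¬A → ¬A }) , (λ { {_ ∷ []} → λ ¬A → ¬A })

  -- The double complement stands for the fibre itself, so that A need not be decidable.
  fibre : Carrier R → Pred (Carrier R) ℓ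
  fibre a y = R ⊨ (v₀ A′ v₁ ⇒ bot) ⇒ bot [ a ∷ y ∷ [] ]

  fibre-definable : ∀ a → Definable (openCore R _<_) {1} (λ v → fibre a (head v))
  fibre-definable a =
    -- No parameter is listed: `a` is absorbed into the symbol naming the open set.
    0 , (rel (fibre-complement a , fibre-complement-open a , fibre-complement-definable a)
             (var v₀ ∷ []) ⇒ bot) , [] ,
    (λ { {_ ∷ []} → λ ¬¬A → ¬¬A }) , (λ { {_ ∷ []} → λ ¬¬A → ¬¬A })

  ∈ᴵ-convex : ∀ {x y z} I → _∈ᴵ_ _<_ x I → _∈ᴵ_ _<_ z I → x < y → y < z → _∈ᴵ_ _<_ y I
  ∈ᴵ-convex I (a<x , _) (_ , z<b) x<y y<z =
    <±-trans _<_ R-<-trans a<x [ x<y ] , <±-trans _<_ R-<-trans [ y<z ] z<b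

  fibre-not-finiteUnion : ∀ a → (∀ n → a A integer n) → ¬ FiniteUnion _<_ (fibre a)
  fibre-not-finiteUnion a Aan (ps , fibre⊆ps , ps⊆fibre) =
    -- One more integer than there are pieces, each sent to the index of a piece containing it.
    noRepeatedPiece (pigeonhole (n<1+n (length ps)) (Any.index ∘ inPiece ∘ toℕ))
    where
    inPiece : ∀ n → Any (_∈ᴾ_ _<_ (integer n)) ps
    inPiece n = fibre⊆ps λ ¬A → ¬A (Aan n)

    noCommonPiece : ∀ {m n P} → m ℕ.< n → P ∈ ps →
      _∈ᴾ_ _<_ (integer m) P → ¬ _∈ᴾ_ _<_ (integer n) P
    noCommonPiece {P = point _}    m<n _   m≡a n≡a =
      integer-injective-< m<n (trans m≡a (sym n≡a))
    noCommonPiece {P = interval I} m<n I∈ps m∈I n∈I =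
      -- Convexity puts `w` in the interval, hence in the double complement of the complement-free
      -- `w`: this contradicts `¬Aaw`.
      let w , m<w , w<n , ¬Aaw = R-fibres-codense a _ _ (integer-mono-< m<n)
      in ⊥-elim (ps⊆fibre (lose I∈ps (∈ᴵ-convex I m∈I n∈I m<w w<n)) ¬Aaw)

    noRepeatedPiece : ¬ (∃₂ λ i j → i Fin.< j ×
      Any.index (inPiece (toℕ i)) ≡ Any.index (inPiece (toℕ j)))
    noRepeatedPiece (i , j , i<j , eq) =
      noCommonPiece i<j (∈-lookup (Any.index (inPiece (toℕ j))))
        (subst (λ k → _∈ᴾ_ _<_ (integer (toℕ i)) (List.lookup ps k)) eq
          (lookup-index (inPiece (toℕ i))))
        (lookup-index (inPiece (toℕ j)))

  -- Saturation.

  IsInteger : Pred (Carrier R) ℓ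
  IsInteger a = ∃[ n ] a ≡ integer n

  -- The index recorded in the witness determines the element, so projecting to it is injective.
  IsInteger↣ℕ : ∃ IsInteger ↣ ℕ
  IsInteger↣ℕ = mk↣ {to = λ (_ , n , _) → n} λ { {_ , _ , refl} {_ , _ , refl} refl → refl }

  contains : ℕ → Formula₁[_] R IsInteger
  contains n = 1 , v₀ A′ v₁ , (integer n , n , refl) ∷ []

  AllIntegers : Pred (Formula₁[_] R IsInteger) ℓ
  AllIntegers φ = ∃[ n ] φ ≡ contains n

  -- Finitely many formulas mention finitely many integers; some rational `x` is related to all of
  -- them, and elementarity carries this to `embed x`.
  allIntegers-finitelySatisfiable : ((F : 𝓕) → Dense (fiber ρ F)) →
    FinitelySatisfiable R AllIntegers
  allIntegers-finitelySatisfiable dense φs φs∈ =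
    let x , Ax = fibre-realizes ρ dense (All.reduce proj₁ φs∈)
    in embed x , satisfied φs∈ λ {n} n∈ →
         Equivalence.to (elementary (v₀ A′ v₁) (x ∷ positiveInteger n ∷ [])) (Ax n∈)
    where
    satisfied : ∀ {a φs} (φs∈ : All AllIntegers φs) →
      (∀ {n} → n ∈ All.reduce proj₁ φs∈ → a A integer n) → All (Satisfies R a) φs
    satisfied []                 _   = []
    satisfied ((_ , refl) ∷ φs∈) Aan = Aan (here refl) ∷ satisfied φs∈ (Aan ∘ there)

  fibre-containing-integers : ((F : 𝓕) → Dense (fiber ρ F)) → ℵ₁-Saturated R →
    ∃[ a ] (∀ n → a A integer n)
  fibre-containing-integers dense saturated =
    let a , realizes = saturated IsInteger IsInteger↣ℕ AllIntegers
                         (allIntegers-finitelySatisfiable dense)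
    in a , λ n → realizes {contains n} (n , refl)

corollary4p8 : {ℓ : Level} (ρ : ℚ<0 → 𝓕) →
    ((F : 𝓕) → Dense (fiber ρ F) × Codense (fiber ρ F)) →
    (R : Structure L<0A ℓ) (e : ℚ-structure ρ ≼ R) →
    ℵ₁-Saturated R → HasInfiniteElement e →
    ¬ OMinimal (openCore R (order R)) (order R)
corollary4p8 ρ dense R e saturated _ oMinimal =
  let a , Aan = fibre-containing-integers e (proj₁ ∘ dense) saturated
  in fibre-not-finiteUnion e a Aan (oMinimal (fibre e a) (fibre-definable e a))
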